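{- $L(4,n) = \Omega\big(n^{\Theta(\ln n)}\big)$ as $n\to\infty$; in particular $L(4,n)$ is not bounded by any polynomial in $n$.
   Context: A coloring game is given by a finite set $V$ of $n$ players and a symmetric weight function $w$ with $w_{uv}=w_{vu}\in \mathbb{Z}\cup\{ -\infty\}$ for distinct $u,v$. A state is a partition $P$ of $V$; $X(u)$ is the group of $u$ and $f_u(P)=\sum_{v\in X(u)\setminus\{u\}} w_{uv}$. A $k$-deviation from $P$ is a set $S$ of at most $k$ players and a (possibly empty) group $X$ of $P$ such that moving all players of $S$ into $X$ strictly increases the utility of every member of $S$. Starting from the all-singletons partition, $k$-deviations are applied successively. The game is uniform if all weights lie in $\{ -\infty,1\}$. $L(k,n)$ is the maximum length of a sequence of successive $k$-deviations (from the all-singletons partition) over all uniform games with at most $n$ players. -}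

module Defs where

open import Data.Nat using (ℕ; zero; suc; _+_; _*_; _^_; _≤_; _<_; _/_)
open import Data.Nat.Logarithm using (⌊log₂_⌋)
import Data.Nat as ℕ
open import Data.Fin using (Fin; toℕ)
import Data.Fin as F
open import Data.Fin.Subset using (Subset; ∣_∣; Nonempty)
open import Data.Vec using (lookup)
open import Data.Bool using (Bool; true; false; if_then_else_)
open import Data.List using (List; filter; length)
open import Data.Bool.ListAction using (any)
open import Data.List.Base using ()
open import Data.Fin.Base using ()
open import Data.Maybe using (Maybe; just; nothing)
open import Data.Product using (Σ; ∃; _×_; _,_)
open import Relation.Nullary using (¬?)
open import Relation.Nullary.Decidable using (_×-dec_)
open import Relation.Binary.PropositionalEquality using (_≡_)
open import Data.List using (allFin)

-- A uniform coloring game on the players Fin m.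
-- Weights are in {-∞, 1}: `conflict u v ≡ true` means w_uv = -∞,
-- `conflict u v ≡ false` means w_uv = 1.  Symmetry is required separately.
Conflict : ℕ → Set
Conflict m = Fin m → Fin m → Bool

Symmetric : ∀ {m} → Conflict m → Set
Symmetric {m} C = (u v : Fin m) → C u v ≡ C v u

-- A state (partition of Fin m) is given by a group label for each player;
-- two players are in the same group iff their labels are equal.
State : ℕ → Set
State m = Fin m → ℕ

singletons : ∀ {m} → State m
singletons = toℕ

mates : ∀ {m} → State m → Fin m → List (Fin m)
mates {m} P u = filter (λ v → ¬? (v F.≟ u) ×-dec (P v ℕ.≟ P u)) (allFin m)

-- Utility values in ℤ ∪ {-∞}; in a uniform game utilities are either -∞
-- (`nothing`) or a natural number (`just k`).
Utility : Set
Utility = Maybe ℕ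

-- f_u(P) = Σ_{v ∈ X(u) \ {u}} w_uv  for a uniform game.
utility : ∀ {m} → Conflict m → State m → Fin m → Utility
utility C P u = if any (C u) (mates P u) then nothing else just (length (mates P u))

data _<ᵤ_ : Utility → Utility → Set where
  -∞<fin : ∀ {b} → nothing <ᵤ just b
  fin<fin : ∀ {a b} → a < b → just a <ᵤ just b

-- Move the players in S into the group with label ℓ.  If no player of P
-- has label ℓ this is the move into the empty group (a new group equal to S).
move : ∀ {m} → State m → Subset m → ℕ → State m
move P S ℓ u = if lookup S u then ℓ else P u

Deviation : ∀ {m} → ℕ → Conflict m → State m → State m → Set
Deviation {m} k C P P' =
  Σ (Subset m) λ S → Σ ℕ λ ℓ →
    Nonempty S × ∣ S ∣ ≤ k × P' ≡ move P S ℓ ×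
    ((u : Fin m) → lookup S u ≡ true → utility C P u <ᵤ utility C P' u)

data Reach {m : ℕ} (k : ℕ) (C : Conflict m) : ℕ → State m → Set where
  start : Reach k C zero singletons
  step  : ∀ {len P P'} → Reach k C len P → Deviation k C P P' → Reach k C (suc len) P'

LAtLeast : ℕ → ℕ → ℕ → Set
LAtLeast k n len =
  Σ ℕ λ m → m ≤ n × Σ (Conflict m) λ C → Symmetric C × ∃ λ P → Reach k C len P

{-# OPTIONS --safe #-}
module Submission where

-- With no conflicts only the multiset of group sizes matters.  Call
-- {i, i} → {i-1, i+1} a shift at i.  It is a single 1-deviation, but it can
-- also be carried out slowly: the 4-deviation {i⁴, i-3} → {(i-1)⁴, i+1}, then a
-- 1-deviation shifting at i-2, then two slow shifts at i-1, together have the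
-- same effect as one shift at i.  The other groups involved act as catalysts, so
-- O(i) spare groups of size O(i), i.e. O(i²) players, support at least 2^(i-3)
-- deviations; i ≈ (log₂ n)² already yields n^(log₂ n).

import Algebra.Solver.CommutativeMonoid as CommutativeMonoidSolver
open import Defs
open import Data.Bool using (true; false; if_then_else_)
open import Data.Bool.ListAction using (any)
open import Data.Empty using (⊥-elim)
open import Data.Fin using (Fin; zero; suc; toℕ)
import Data.Fin as F
open import Data.Fin.Properties using (toℕ-injective)
open import Data.Fin.Subset using (Subset; ∣_∣; Nonempty; inside; outside; ⊥)
open import Data.Fin.Subset.Properties using (∣⊥∣≡0)
open import Data.List using (List; []; _∷_; _++_; [_]; map; length; filter; allFin; replicate)
open import Data.List.Properties using (∷-injective; length-tabulate; ++-identityʳ; map-++; map-∘; map-cong-local; filter-none)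
open import Data.List.Membership.Propositional using (_∈_; _∉_)
open import Data.List.Membership.Propositional.Properties using (∈-allFin; ∈-filter⁻; ∈-map⁺)
open import Data.List.Relation.Binary.Permutation.Propositional using (_↭_; swap; ↭-refl; ↭-reflexive; ↭-sym; ↭⇒↭ₛ)
open import Data.List.Relation.Binary.Permutation.Propositional.Properties using (↭-map-inv; ++-commutativeMonoid; shift)
open import Data.List.Relation.Binary.Permutation.Setoid.Properties using (Unique-resp-↭)
open import Data.List.Relation.Unary.All as All using (All; []; _∷_)
import Data.List.Relation.Unary.All.Properties as All
open import Data.List.Relation.Unary.AllPairs using ([]; _∷_)
open import Data.List.Relation.Unary.Any using (here; there)
open import Data.List.Relation.Unary.Unique.Propositional using (Unique)
open import Data.List.Relation.Unary.Unique.Propositional.Properties using (allFin⁺; map⁺)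
open import Data.Maybe using (just)
open import Data.Nat using (ℕ; zero; suc; _+_; _*_; _^_; _/_; ⌊_/2⌋; ⌈_/2⌉; _∸_; _≤_; _<_; z≤n; s≤s; z<s; _≟_; _≤?_; NonZero)
open import Data.Nat.DivMod using (n/1≡n)
open import Data.Nat.Induction using (<-rec)
open import Data.Nat.ListAction using (sum)
open import Data.Nat.Logarithm using (⌊log₂_⌋; ⌊log₂⌊n/2⌋⌋≡⌊log₂n⌋∸1; ⌊log₂⌋-mono-≤; ⌊log₂[2^n]⌋≡n)
open import Data.Nat.Tactic.RingSolver using (solve-∀)
open import Data.Nat.Properties
open import Data.Product using (Σ; ∃; _×_; _,_; proj₁; proj₂)
open import Data.Vec using (_[_]≔_; lookup)
import Data.Vec as Vec
open import Data.Vec.Properties using (lookup∘update; lookup∘update′; lookup⇒[]=; lookup-replicate)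
open import Data.Vec.Functional using (updateAt)
open import Data.Vec.Functional.Properties using (updateAt-updates; updateAt-minimal)
open import Function using (_∘_; const)
open import Relation.Binary.PropositionalEquality
  using (_≡_; _≢_; _≗_; refl; sym; trans; cong; cong₂; subst; setoid; module ≡-Reasoning)
open import Relation.Nullary using (¬_; yes; no; contradiction)
open import Relation.Unary using (Decidable)

-- Counting group sizes in the conflict-free game.

module _ {A : Set} {Q R : A → Set} (Q? : Decidable Q) (R? : Decidable R) where

  length-filter-cong : ∀ {xs} → All (λ x → (Q x → R x) × (R x → Q x)) xs →
                       length (filter Q? xs) ≡ length (filter R? xs)
  length-filter-cong [] = refl
  length-filter-cong {x ∷ xs} ((to , from) ∷ eqs) with Q? x | R? x
  ... | yes _ | yes _ = cong suc (length-filter-cong eqs)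
  ... | yes q | no ¬r = contradiction (to q) ¬r
  ... | no ¬q | yes r = contradiction (from r) ¬q
  ... | no _  | no _  = length-filter-cong eqs

  -- The predicates differ only at `u`, which `Unique` lets the count meet exactly once. The counts
  -- for mates, singletons and relabelled players are all instances.
  length-filter-suc : ∀ {u xs} → Unique xs → u ∈ xs → Q u → ¬ R u →
                      (∀ x → x ≢ u → (Q x → R x) × (R x → Q x)) →
                      length (filter Q? xs) ≡ suc (length (filter R? xs))
  length-filter-suc {u} (u∉ ∷ _) (here refl) q ¬r eqs with Q? u | R? u
  ... | yes _ | no _  = cong suc (length-filter-cong (All.map (λ u≢x → eqs _ (u≢x ∘ sym)) u∉))
  ... | yes _ | yes r = contradiction r ¬r
  ... | no ¬q | _     = contradiction q ¬q
  length-filter-suc {xs = x ∷ _} (x∉ ∷ uniq) (there u∈) q ¬r eqs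
    with Q? x | R? x | length-filter-suc uniq u∈ q ¬r eqs | eqs x (All.lookup x∉ u∈)
  ... | yes _ | yes _ | ih | _ = cong suc ih
  ... | yes q′ | no ¬r′ | _ | to , _ = contradiction (to q′) ¬r′
  ... | no ¬q′ | yes r′ | _ | _ , from = contradiction (from r′) ¬q′
  ... | no _  | no _  | ih | _ = ih

module _ {m : ℕ} where

  noConflict : Conflict m
  noConflict _ _ = false

  size : State m → ℕ → ℕ
  size P x = length (filter (λ v → P v ≟ x) (allFin m))

  size-cong : ∀ {P P′ : State m} → P ≗ P′ → size P ≗ size P′
  size-cong P≗P′ x = length-filter-cong _ _ (All.universal
    (λ v → (λ e → trans (sym (P≗P′ v)) e) , trans (P≗P′ v)) (allFin m))

  size-mates : ∀ P u → size P (P u) ≡ suc (length (mates P u))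
  size-mates P u = length-filter-suc _ _ (allFin⁺ m) (∈-allFin u) refl (λ (u≢u , _) → u≢u refl)
    (λ _ v≢u → (v≢u ,_) , proj₂)

  any-noConflict : ∀ u vs → any (noConflict u) vs ≡ false
  any-noConflict u []       = refl
  any-noConflict u (_ ∷ vs) = any-noConflict u vs

  utility≡just : ∀ P u → utility noConflict P u ≡ just (length (mates P u))
  utility≡just P u rewrite any-noConflict u (mates P u) = refl

  -- Without conflicts a utility is the size of the player's own group minus one, so a strict gain
  -- in size is a strict gain in utility.
  size<⇒utility< : ∀ {P P′ : State m} {u} → size P (P u) < size P′ (P′ u) →
                       utility noConflict P u <ᵤ utility noConflict P′ u
  size<⇒utility< {P} {P′} {u} lt
    rewrite utility≡just P u | utility≡just P′ u | size-mates P u | size-mates P′ u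
    = fin<fin (≤-pred lt)

  inhabitant : ∀ {P : State m} {x a} → size P x ≡ suc a → ∃ λ u → P u ≡ x
  inhabitant {P} {x} eq with filter (λ v → P v ≟ x) (allFin m)
    in filter≡
  ... | v ∷ vs = v , proj₂ (∈-filter⁻ (λ v → P v ≟ x) {xs = allFin m}
                              (subst (v ∈_) (sym filter≡) (here refl)))

  size-singletons : ∀ u → size singletons (toℕ u) ≡ 1
  size-singletons u = trans
    (length-filter-suc _ (λ _ → no (λ ())) (allFin⁺ m) (∈-allFin u) refl (λ ())
      (λ v v≢u → (λ e → ⊥-elim (v≢u (toℕ-injective e))) , ⊥-elim))
    (cong (suc ∘ length) (filter-none (λ _ → no (λ ())) (All.universal (λ _ ()) (allFin m))))

  module _ (P : State m) (u : Fin m) (ℓ : ℕ) where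

    relabel : State m
    relabel = updateAt P u (const ℓ)

    relabel-self : relabel u ≡ ℓ
    relabel-self = updateAt-updates u P

    relabel-other : ∀ v → v ≢ u → relabel v ≡ P v
    relabel-other v v≢u = updateAt-minimal v u P v≢u

    size-relabel-target : P u ≢ ℓ → size relabel ℓ ≡ suc (size P ℓ)
    size-relabel-target Pu≢ℓ = length-filter-suc _ _ (allFin⁺ m) (∈-allFin u) relabel-self Pu≢ℓ
      λ v v≢u → trans (sym (relabel-other v v≢u)) , trans (relabel-other v v≢u)

    size-relabel-source : P u ≢ ℓ → size P (P u) ≡ suc (size relabel (P u))
    size-relabel-source Pu≢ℓ = length-filter-suc _ _ (allFin⁺ m) (∈-allFin u) refl
      (λ e → Pu≢ℓ (trans (sym e) relabel-self))
      λ v v≢u → trans (relabel-other v v≢u) , trans (sym (relabel-other v v≢u))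

    size-relabel-other : ∀ {z} → z ≢ P u → z ≢ ℓ → size relabel z ≡ size P z
    size-relabel-other {z} z≢Pu z≢ℓ = length-filter-cong _ _ (All.universal same (allFin m))
      where
      same : ∀ v → (relabel v ≡ z → P v ≡ z) × (P v ≡ z → relabel v ≡ z)
      same v with v F.≟ u
      ... | yes refl = (λ e → ⊥-elim (z≢ℓ (trans (sym e) relabel-self))) , λ e → ⊥-elim (z≢Pu (sym e))
      ... | no v≢u   = trans (sym (relabel-other v v≢u)) , trans (relabel-other v v≢u)

-- Simultaneous moves out of several groups.

∣p[i]≔inside∣≤1+∣p∣ : ∀ {n} (p : Subset n) i → ∣ p [ i ]≔ inside ∣ ≤ suc ∣ p ∣
∣p[i]≔inside∣≤1+∣p∣ (true Vec.∷ p) zero     = n≤1+n _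
∣p[i]≔inside∣≤1+∣p∣ (false Vec.∷ p) zero    = ≤-refl
∣p[i]≔inside∣≤1+∣p∣ (true Vec.∷ p) (suc i)  = s≤s (∣p[i]≔inside∣≤1+∣p∣ p i)
∣p[i]≔inside∣≤1+∣p∣ (false Vec.∷ p) (suc i) = ∣p[i]≔inside∣≤1+∣p∣ p i

-- One player leaves each group in `ls`, and `as` records the sizes that remain. A deviation demands
-- only an upper bound on the number of movers; `nonempty` is conditional so that the induction can
-- start with no sources.
record Gathers {m} (P : State m) (ℓ : ℕ) (ls as : List ℕ) : Set where
  field
    movers      : Subset m
    movers-≤    : ∣ movers ∣ ≤ length as
    nonempty    : 0 < length as → Nonempty movers
    from-ls     : ∀ u → lookup movers u ≡ true → P u ∈ ls
    size-target : size (move P movers ℓ) ℓ ≡ size P ℓ + length as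
    size-ls     : map (size (move P movers ℓ)) ls ≡ as
    size-other  : ∀ {z} → z ≢ ℓ → z ∉ ls → size (move P movers ℓ) z ≡ size P z

-- Induction on the sources: relabel one player `u` of the first group, then gather from the others
-- in the resulting state `P₁`. Distinct labels keep the two stages from interfering.
gather : ∀ {m} (P : State m) {ℓ} ls as → Unique (ℓ ∷ ls) → map (size P) ls ≡ map suc as →
         Gathers P ℓ ls as
gather {m} P {ℓ} [] [] _ refl = record
  { movers      = ⊥
  ; movers-≤    = ≤-reflexive (∣⊥∣≡0 m)
  ; nonempty    = λ ()
  ; from-ls     = λ u e → contradiction (trans (sym (lookup-replicate u outside)) e) λ ()
  ; size-target = trans (unmoved ℓ) (sym (+-identityʳ _))
  ; size-ls     = refl
  ; size-other  = λ _ _ → unmoved _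
  }
  where
  unmoved : size (move P ⊥ ℓ) ≗ size P
  unmoved = size-cong λ v → cong (if_then ℓ else P v) (lookup-replicate v outside)
gather {m} P {ℓ} (x ∷ xs) (a ∷ as) ((ℓ≢x ∷ ℓ∉xs) ∷ (x∉xs ∷ xs!)) eq
  with inhabitant {P = P} (proj₁ (∷-injective eq))
... | u , refl = record
  { movers      = S
  ; movers-≤    = ≤-trans (∣p[i]≔inside∣≤1+∣p∣ movers u) (s≤s movers-≤)
  ; nonempty    = λ _ → u , lookup⇒[]= u S (lookup∘update u movers true)
  ; from-ls     = from
  ; size-target = begin
      size (move P S ℓ) ℓ           ≡⟨ same ℓ ⟩
      size (move P₁ movers ℓ) ℓ     ≡⟨ size-target ⟩
      size P₁ ℓ + length as         ≡⟨ cong (_+ length as) (size-relabel-target P u ℓ (ℓ≢x ∘ sym)) ⟩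
      suc (size P ℓ + length as)    ≡⟨ +-suc _ _ ⟨
      size P ℓ + suc (length as)    ∎
  ; size-ls     = cong₂ _∷_
      (trans (same (P u)) (trans (size-other (ℓ≢x ∘ sym) (λ x∈ → All.lookup x∉xs x∈ refl))
        (suc-injective (trans (sym (size-relabel-source P u ℓ (ℓ≢x ∘ sym))) (proj₁ (∷-injective eq))))))
      (trans (map-cong-local (All.universal same xs)) size-ls)
  ; size-other  = λ z≢ℓ z∉ → trans (same _) (trans (size-other z≢ℓ (z∉ ∘ there))
      (size-relabel-other P u ℓ (z∉ ∘ here) z≢ℓ))
  }
  where
  open ≡-Reasoning
  P₁ = relabel P u ℓ
  size-xs : map (size P₁) xs ≡ map suc as
  size-xs = trans
    (map-cong-local (All.zipWith (λ (x≢z , ℓ≢z) → size-relabel-other P u ℓ (x≢z ∘ sym) (ℓ≢z ∘ sym))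
                                 (x∉xs , ℓ∉xs)))
    (proj₂ (∷-injective eq))
  open Gathers (gather P₁ xs as (ℓ∉xs ∷ xs!) size-xs)
  S = movers [ u ]≔ inside
  same : size (move P S ℓ) ≗ size (move P₁ movers ℓ)
  same = size-cong pointwise
    where
    pointwise : move P S ℓ ≗ move P₁ movers ℓ
    pointwise v with v F.≟ u
    -- `u` already carries the label `ℓ` in `P₁`, so its membership in `movers` makes no difference.
    ... | yes refl rewrite lookup∘update u movers true | relabel-self P u ℓ with lookup movers u
    ...   | true  = refl
    ...   | false = refl
    pointwise v | no v≢u
      rewrite lookup∘update′ v≢u movers true | relabel-other P u ℓ v v≢u = refl
  from : ∀ v → lookup S v ≡ true → P v ∈ P u ∷ xs
  from v e with v F.≟ u
  ... | yes refl = here refl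
  ... | no v≢u   = there (subst (_∈ xs) (relabel-other P u ℓ v v≢u)
                     (from-ls v (trans (sym (lookup∘update′ v≢u movers true)) e)))

-- Reachability expressed through lists of group sizes.

map-const⁺ : ∀ {A : Set} {f : A → ℕ} {c xs} → All (λ x → f x ≡ c) xs →
             map f xs ≡ replicate (length xs) c
map-const⁺ []         = refl
map-const⁺ (eq ∷ eqs) = cong₂ _∷_ eq (map-const⁺ eqs)

map-++⁻ : ∀ {A : Set} {f : A → ℕ} {zs} xs {ys} → map f zs ≡ xs ++ ys →
          ∃ λ zs₁ → ∃ λ zs₂ → zs ≡ zs₁ ++ zs₂ × map f zs₁ ≡ xs × map f zs₂ ≡ ys
map-++⁻ []                     eq = [] , _ , refl , refl , eq
map-++⁻ {zs = z ∷ zs} (x ∷ xs) eq with ∷-injective eq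
... | refl , eq′ with map-++⁻ xs eq′
...   | zs₁ , zs₂ , refl , refl , eq₂ = z ∷ zs₁ , zs₂ , refl , refl , eq₂

unique-++⁻ : ∀ {A : Set} (xs : List A) {ys} → Unique (xs ++ ys) →
             Unique xs × (∀ {y} → y ∈ ys → y ∉ xs)
unique-++⁻ []       _            = [] , λ _ ()
unique-++⁻ (x ∷ xs) (x∉ ∷ uniq) with unique-++⁻ xs uniq
... | xs! , disjoint = All.++⁻ˡ xs x∉ ∷ xs! , λ where
  y∈ (here refl) → All.lookup (All.++⁻ʳ xs x∉) y∈ refl
  y∈ (there y∈xs) → disjoint y∈ y∈xs

-- Only some of the groups need to be listed in L.
HasGroups : ∀ {m} → State m → List ℕ → Set
HasGroups P L = ∃ λ labels → Unique labels × map (size P) labels ≡ L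

-- Bounding the length from below, rather than fixing it, lets preparatory deviations go uncounted.
Attains : ℕ → ℕ → List ℕ → Set
Attains m len L = ∃ λ len′ → len ≤ len′ × Σ (State m) λ P → Reach 4 noConflict len′ P × HasGroups P L

module _ {m : ℕ} where

  attains-≤ : ∀ {len len′ L} → len ≤ len′ → Attains m len′ L → Attains m len L
  attains-≤ le (_ , le′ , rest) = _ , ≤-trans le le′ , rest

  attains-↭ : ∀ {len L L′} → L ↭ L′ → Attains m len L → Attains m len L′
  attains-↭ L↭L′ (_ , le , P , r , labels , uniq , refl) with ↭-map-inv (size P) L↭L′
  ... | labels′ , refl , labels↭ =
    _ , le , P , r , labels′ , Unique-resp-↭ (setoid ℕ) (↭⇒↭ₛ labels↭) uniq , refl

  attains-tail : ∀ {len x L} → Attains m len (x ∷ L) → Attains m len L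
  attains-tail (_ , le , P , r , _ ∷ labels , _ ∷ uniq , eq) =
    _ , le , P , r , labels , uniq , proj₂ (∷-injective eq)

  attains-singletons : Attains m 0 (replicate m 1)
  attains-singletons =
    0 , z≤n , singletons , start , map toℕ (allFin m) , map⁺ toℕ-injective (allFin⁺ m) , (begin
      map (size {m} singletons) (map toℕ (allFin m))  ≡⟨ map-∘ (allFin m) ⟨
      map (size {m} singletons ∘ toℕ) (allFin m)      ≡⟨ map-const⁺ (All.universal size-singletons (allFin m)) ⟩
      replicate (length (allFin m)) 1             ≡⟨ cong (λ k → replicate k 1) (length-tabulate {n = m} _) ⟩
      replicate m 1                               ∎)
    where open ≡-Reasoning

  -- The head group receives one player from each of the groups `map suc as`. A mover passes from a
  -- group of size `suc a` to one of size `c`, so the condition on `as` says that every mover gains.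
  -- Keeping `c` apart from `b + length as` lets calls supply a simplified size.
  attains-deviation : ∀ {len} as b c bs → 0 < length as → length as ≤ 4 → b + length as ≡ c →
                      All (λ a → suc a < c) as →
                      Attains m len (b ∷ map suc as ++ bs) → Attains m (suc len) (c ∷ as ++ bs)
  attains-deviation as b c bs 0<k k≤4 c≡ as<c (len′ , le , P , r , ℓ ∷ labels , ℓ∉ ∷ uniq , eq)
    with ∷-injective eq
  ... | size-ℓ , eq′ with map-++⁻ (map suc as) eq′
  ...   | ls , rs , refl , ls≡ , refl =
    suc len′ , s≤s le , P′ ,
    step r (movers , ℓ , nonempty 0<k , ≤-trans movers-≤ k≤4 , refl ,
            λ u u∈ → size<⇒utility< {P = P} {P′} (size< u u∈)) ,
    ℓ ∷ ls ++ rs , ℓ∉ ∷ uniq ,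
    cong₂ _∷_ size-ℓ′ (trans (map-++ (size P′) ls rs) (cong₂ _++_ size-ls
      (map-cong-local (All.tabulate λ z∈ →
        size-other (All.lookup (All.++⁻ʳ ls ℓ∉) z∈ ∘ sym) (disjoint z∈)))))
    where
    ls! = proj₁ (unique-++⁻ ls uniq)
    disjoint = proj₂ (unique-++⁻ ls uniq)
    open Gathers (gather P ls as (All.++⁻ˡ ls ℓ∉ ∷ ls!) ls≡)
    P′ = move P movers ℓ
    size-ℓ′ : size P′ ℓ ≡ c
    size-ℓ′ = trans size-target (trans (cong (_+ length as) size-ℓ) c≡)
    size< : ∀ u → lookup movers u ≡ true → size P (P u) < size P′ (P′ u)
    size< u u∈ rewrite u∈ = subst (size P (P u) <_) (sym size-ℓ′)
      (All.lookup {P = _< c} (All.map⁺ as<c) (subst (size P (P u) ∈_) ls≡ (∈-map⁺ (size P) (from-ls u u∈))))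

  -- Singletons join the head group one at a time; each such 1-deviation pays because that group is
  -- nonempty.
  attains-merge : ∀ {len} x y z R → 0 < x → Attains m len (x ∷ replicate (y + z) 1 ++ R) →
                  Attains m len (x + y ∷ replicate z 1 ++ R)
  attains-merge x zero    z R 0<x att rewrite +-identityʳ x = att
  attains-merge x (suc y) z R 0<x att rewrite +-suc x y =
    -- The abandoned singleton stays in the list as a group of size 0, so it is swapped to the front
    -- and dropped. The deviation itself is left out of the count.
    attains-merge (suc x) y z R z<s (attains-tail (attains-↭ (swap _ _ ↭-refl) (attains-≤ (n≤1+n _)
      (attains-deviation [ 0 ] x (suc x) _ z<s (s≤s z≤n) (+-comm x 1) (s≤s 0<x ∷ []) att))))

  -- Each group is seeded by one singleton and filled from the pool; once finished it is shifted
  -- behind the remaining singletons and becomes part of `R`.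
  attains-groups : ∀ {len} L R → All (0 <_) L → Attains m len (replicate (sum L) 1 ++ R) →
                   Attains m len (L ++ R)
  attains-groups []          R _            att = att
  attains-groups (suc x ∷ L) R (_ ∷ 0<L) att =
    attains-↭ (shift (suc x) L R) (attains-groups L (suc x ∷ R) 0<L
      (attains-↭ (↭-sym (shift (suc x) (replicate (sum L) 1) R))
        (attains-merge 1 x (sum L) R z<s att)))

-- The recursive slow shift.

-- Each level holds what a slow shift at i = 4 + s borrows: two further groups of size i, the
-- receiver of size i - 3, and the pair for the shift at i - 2. The lower levels serve the slow
-- shifts at i - 1. The recursion stops at i = 3, where a plain shift is used.
catalyst : ℕ → List ℕ
catalyst zero    = []
catalyst (suc s) = 4 + s ∷ 4 + s ∷ 1 + s ∷ 2 + s ∷ 2 + s ∷ catalyst s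

module _ where
  open CommutativeMonoidSolver (++-commutativeMonoid {A = ℕ}) using (solve; _⊕_; _⊜_)

  -- The shift at 3 + s; in the recursive case the deviations are applied from
  -- the last line of the term upwards.
  slow-shift : ∀ {m len} s R → Attains m len (3 + s ∷ 3 + s ∷ catalyst s ++ R) →
               Attains m (2 ^ s + len) (2 + s ∷ 4 + s ∷ catalyst s ++ R)
  slow-shift zero R att = attains-↭ (swap 4 2 ↭-refl)
    (attains-deviation [ 2 ] 3 4 R z<s (s≤s z≤n) refl (≤-refl ∷ []) att)
  slow-shift {m} {len} (suc s) R att =
    attains-≤ enough
    -- Apart from the shifted pair `a`, `c`, the groups left over are two `e`, one `b`, two `d` and
    -- `K`: the catalyst is restored in full.
    (attains-↭ (solve 7 (λ a b c d e K R →
        d ⊕ e ⊕ K ⊕ a ⊕ b ⊕ c ⊕ d ⊕ e ⊕ R ⊜ a ⊕ c ⊕ e ⊕ e ⊕ b ⊕ d ⊕ d ⊕ K ⊕ R)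
      ↭-refl [ a ] [ b ] [ c ] [ d ] [ e ] K R)
    -- The second slow shift at `a` reuses `K`, which the first one returned intact.
    (slow-shift s (a ∷ b ∷ c ∷ d ∷ e ∷ R)
    (attains-↭ (solve 7 (λ a b c d e K R →
        d ⊕ e ⊕ K ⊕ a ⊕ a ⊕ a ⊕ b ⊕ c ⊕ R ⊜ a ⊕ a ⊕ K ⊕ a ⊕ b ⊕ c ⊕ d ⊕ e ⊕ R)
      ↭-refl [ a ] [ b ] [ c ] [ d ] [ e ] K R)
    (slow-shift s (a ∷ a ∷ a ∷ b ∷ c ∷ R)
    (attains-↭ (solve 5 (λ a b c K R →
        a ⊕ b ⊕ c ⊕ a ⊕ a ⊕ a ⊕ a ⊕ K ⊕ R ⊜ a ⊕ a ⊕ K ⊕ a ⊕ a ⊕ a ⊕ b ⊕ c ⊕ R)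
      ↭-refl [ a ] [ b ] [ c ] K R)
    (attains-deviation [ b ] d a (c ∷ a ∷ a ∷ a ∷ a ∷ K ++ R) z<s (s≤s z≤n)
      (+-comm d 1) (≤-refl ∷ [])
    (attains-↭ (solve 5 (λ a c d K R →
        c ⊕ a ⊕ a ⊕ a ⊕ a ⊕ d ⊕ d ⊕ K ⊕ R ⊜ d ⊕ d ⊕ c ⊕ a ⊕ a ⊕ a ⊕ a ⊕ K ⊕ R)
      ↭-refl [ a ] [ c ] [ d ] K R)
    -- Of the four groups of size `e`, two are the pair to be shifted and two come from the
    -- catalyst, as does the receiver of size `b`.
    (attains-deviation (a ∷ a ∷ a ∷ a ∷ []) b c (d ∷ d ∷ K ++ R) z<s ≤-refl
      (+-comm b 4) (≤-refl ∷ ≤-refl ∷ ≤-refl ∷ ≤-refl ∷ [])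
    (attains-↭ (solve 5 (λ b d e K R →
        e ⊕ e ⊕ e ⊕ e ⊕ b ⊕ d ⊕ d ⊕ K ⊕ R ⊜ b ⊕ e ⊕ e ⊕ e ⊕ e ⊕ d ⊕ d ⊕ K ⊕ R)
      ↭-refl [ b ] [ d ] [ e ] K R) att)))))))))
    where
    a = 3 + s
    b = 1 + s
    c = 5 + s
    d = 2 + s
    e = 4 + s
    K = catalyst s
    -- The two recursive calls double the length; the extra 2 counts the 4-deviation and the plain
    -- shift at `d`, and is discarded.
    enough : 2 ^ suc s + len ≤ 2 ^ s + (2 ^ s + suc (suc len))
    enough = begin
      2 ^ s + (2 ^ s + 0) + len            ≡⟨ cong (λ t → 2 ^ s + t + len) (+-identityʳ _) ⟩
      2 ^ s + 2 ^ s + len                  ≡⟨ +-assoc (2 ^ s) _ _ ⟩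
      2 ^ s + (2 ^ s + len)                ≤⟨ +-monoʳ-≤ (2 ^ s) (+-monoʳ-≤ (2 ^ s) (m≤n+m len 2)) ⟩
      2 ^ s + (2 ^ s + suc (suc len))      ∎
      where open ≤-Reasoning

-- Number of players and the resulting bound on L(4, n).

initialGroups : ℕ → List ℕ
initialGroups s = 3 + s ∷ 3 + s ∷ catalyst s

0<catalyst : ∀ s → All (0 <_) (catalyst s)
0<catalyst zero    = []
0<catalyst (suc s) = z<s ∷ z<s ∷ z<s ∷ z<s ∷ z<s ∷ 0<catalyst s

sum-initialGroups : ∀ s → sum (initialGroups s) ≤ 13 * (suc s * suc s)
sum-initialGroups zero    = m≤m+n 6 7
sum-initialGroups (suc s) = begin
  sum (initialGroups (suc s))                    ≡⟨ lhs s (sum (catalyst s)) ⟩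
  -- A new level costs 15 + 5s players while the quadratic bound grows by 39 + 26s; 24 + 21s is the
  -- slack.
  sum (initialGroups s) + (15 + 5 * s)           ≤⟨ +-mono-≤ (sum-initialGroups s) (m≤m+n _ (24 + 21 * s)) ⟩
  13 * (suc s * suc s) + (15 + 5 * s + (24 + 21 * s))  ≡⟨ rhs s ⟩
  13 * (suc (suc s) * suc (suc s))               ∎
  where
  open ≤-Reasoning
  lhs : ∀ s k → 4 + s + (4 + s + (4 + s + (4 + s + (1 + s + (2 + s + (2 + s + k)))))) ≡
                3 + s + (3 + s + k) + (15 + 5 * s)
  lhs = solve-∀
  rhs : ∀ s → 13 * (suc s * suc s) + (15 + 5 * s + (24 + 21 * s)) ≡ 13 * (suc (suc s) * suc (suc s))
  rhs = solve-∀

-- `LAtLeast` asks for an exact length, so a run that is too long is cut back to a prefix.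
reach-≤ : ∀ {m k C len len′ P} → len ≤ len′ → Reach {m} k C len′ P → ∃ λ P′ → Reach k C len P′
reach-≤ {len = zero} _ _ = singletons , start
reach-≤ {len = suc len} {suc len′} le r@(step r′ _) with suc len ≟ suc len′
... | yes refl = _ , r
... | no  ≢    = reach-≤ (≤-pred (≤∧≢⇒< le ≢)) r′

lAtLeast-≤ : ∀ {k n len len′} → len ≤ len′ → LAtLeast k n len′ → LAtLeast k n len
lAtLeast-≤ le (m , m≤n , C , symC , P , r) = m , m≤n , C , symC , reach-≤ le r

attains⇒lAtLeast : ∀ {m n len L} → m ≤ n → Attains m len L → LAtLeast 4 n len
attains⇒lAtLeast m≤n (_ , le , P , r , _) =
  lAtLeast-≤ le (_ , m≤n , noConflict , (λ _ _ → refl) , P , r)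

attains-initialGroups : ∀ s → Attains (sum (initialGroups s)) 0 (initialGroups s ++ [])
attains-initialGroups s = attains-groups (initialGroups s) [] (z<s ∷ z<s ∷ 0<catalyst s)
  (attains-↭ (↭-reflexive (sym (++-identityʳ _))) attains-singletons)

lAtLeast-2^ : ∀ s {n len} → 13 * (suc s * suc s) ≤ n → len ≤ 2 ^ s → LAtLeast 4 n len
lAtLeast-2^ s n≥ len≤ = attains⇒lAtLeast (≤-trans (sum-initialGroups s) n≥)
  (attains-≤ (≤-trans len≤ (m≤m+n (2 ^ s) 0)) (slow-shift s [] (attains-initialGroups s)))

-- Logarithms and growth estimates.

2^⌊log₂n⌋≤n : ∀ n → 0 < n → 2 ^ ⌊log₂ n ⌋ ≤ n
2^⌊log₂n⌋≤n = <-rec _ go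
  where
  open ≤-Reasoning
  go : ∀ n → (∀ {k} → k < n → 0 < k → 2 ^ ⌊log₂ k ⌋ ≤ k) → 0 < n → 2 ^ ⌊log₂ n ⌋ ≤ n
  go 1             _   _ = ≤-refl
  go n@(suc (suc n′)) rec _ = begin
    2 ^ ⌊log₂ n ⌋                ≤⟨ ^-monoʳ-≤ 2 (m≤n+m∸n ⌊log₂ n ⌋ 1) ⟩
    2 ^ suc (⌊log₂ n ⌋ ∸ 1)      ≡⟨ cong (λ l → 2 ^ suc l) (⌊log₂⌊n/2⌋⌋≡⌊log₂n⌋∸1 n) ⟨
    2 * 2 ^ ⌊log₂ ⌊ n /2⌋ ⌋      ≤⟨ *-monoʳ-≤ 2 (rec (⌊n/2⌋<n (suc n′)) z<s) ⟩
    ⌊ n /2⌋ + (⌊ n /2⌋ + 0)      ≡⟨ cong (⌊ n /2⌋ +_) (+-identityʳ _) ⟩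
    ⌊ n /2⌋ + ⌊ n /2⌋            ≤⟨ +-monoʳ-≤ ⌊ n /2⌋ (⌊n/2⌋≤⌈n/2⌉ n) ⟩
    ⌊ n /2⌋ + ⌈ n /2⌉            ≡⟨ ⌊n/2⌋+⌈n/2⌉≡n n ⟩
    n                            ∎

2^e≤n⇒0<n : ∀ e {n} → 2 ^ e ≤ n → 0 < n
2^e≤n⇒0<n e 2^e≤n = ≤-trans (m^n>0 2 e) 2^e≤n

2^e≤n⇒e≤⌊log₂n⌋ : ∀ e {n} → 2 ^ e ≤ n → e ≤ ⌊log₂ n ⌋
2^e≤n⇒e≤⌊log₂n⌋ e {n} 2^e≤n = subst (_≤ ⌊log₂ n ⌋) (⌊log₂[2^n]⌋≡n e) (⌊log₂⌋-mono-≤ 2^e≤n)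

n≤2^1+⌊log₂n⌋ : ∀ n → n ≤ 2 ^ suc ⌊log₂ n ⌋
n≤2^1+⌊log₂n⌋ n with n ≤? 2 ^ suc ⌊log₂ n ⌋
... | yes n≤ = n≤
... | no  n≰ = contradiction
  (2^e≤n⇒e≤⌊log₂n⌋ (suc ⌊log₂ n ⌋) (<⇒≤ (≰⇒> n≰))) 1+n≰n

-- With l = x + 22 and s = (l + 1)l, this says that the players needed for a slow shift of depth s
-- fit into 2^l. The offset 22 is sharp: at l = 21 the inequality fails. In the inductive step the
-- right side doubles, while the square on the left less than doubles.
quartic≤2^ : ∀ x → let s = suc (x + 22) * (x + 22) in 13 * (suc s * suc s) ≤ 2 ^ (x + 22)
quartic≤2^ zero    = ≤ᵇ⇒≤ (13 * (507 * 507)) (2 ^ 22) _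
quartic≤2^ (suc x) = begin
  13 * (s′ * s′)                     ≤⟨ *-monoʳ-≤ 13 (m≤m+n (s′ * s′) q) ⟩
  13 * (s′ * s′ + q)                 ≡⟨ cong (13 *_) (double x) ⟨
  13 * (2 * (s * s))                 ≡⟨ *-assoc 13 2 (s * s) ⟨
  26 * (s * s)                       ≡⟨ *-assoc 2 13 (s * s) ⟩
  2 * (13 * (s * s))                 ≤⟨ *-monoʳ-≤ 2 (quartic≤2^ x) ⟩
  2 * 2 ^ (x + 22)                   ∎
  where
  open ≤-Reasoning
  s = suc (suc (x + 22) * (x + 22))
  s′ = suc (suc (suc x + 22) * (suc x + 22))
  -- The exact difference between `2 * (s * s)` and `s′ * s′`; expanded in `x`, all its coefficients
  -- are natural numbers, so no subtraction arises.
  q = x * x * x * x + 86 * (x * x * x) + 2763 * (x * x) + 39278 * x + 208289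
  double : ∀ x → 2 * (suc (suc (x + 22) * (x + 22)) * suc (suc (x + 22) * (x + 22))) ≡
    suc (suc (suc x + 22) * (suc x + 22)) * suc (suc (suc x + 22) * (suc x + 22)) +
    (x * x * x * x + 86 * (x * x * x) + 2763 * (x * x) + 39278 * x + 208289)
  double = solve-∀

-- Depth (l + 1)l is chosen because n ≤ 2^(l + 1) gives n^l ≤ 2^((l + 1)l), while the player count
-- is only quartic in l and so at most 2^l ≤ n.
lAtLeast-n^log : ∀ n → 2 ^ 22 ≤ n → LAtLeast 4 n (n ^ (⌊log₂ n ⌋ / 1))
lAtLeast-n^log n N≤n = lAtLeast-2^ (suc l * l) players (begin
  n ^ (l / 1)            ≡⟨ cong (n ^_) (n/1≡n l) ⟩
  n ^ l                  ≤⟨ ^-monoˡ-≤ l (n≤2^1+⌊log₂n⌋ n) ⟩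
  (2 ^ suc l) ^ l        ≡⟨ ^-*-assoc 2 (suc l) l ⟩
  2 ^ (suc l * l)        ∎)
  where
  open ≤-Reasoning
  l = ⌊log₂ n ⌋
  22≤l : 22 ≤ l
  22≤l = 2^e≤n⇒e≤⌊log₂n⌋ 22 N≤n
  players : 13 * (suc (suc l * l) * suc (suc l * l)) ≤ n
  players = ≤-trans
    (subst (λ l → 13 * (suc (suc l * l) * suc (suc l * l)) ≤ 2 ^ l) (m∸n+n≡m 22≤l)
      (quartic≤2^ (l ∸ 22)))
    (2^⌊log₂n⌋≤n n (2^e≤n⇒0<n 22 N≤n))

1+2c≤2^1+c : ∀ c → suc (c + c) ≤ 2 ^ suc c
1+2c≤2^1+c zero    = s≤s z≤n
1+2c≤2^1+c (suc c) = begin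
  suc (suc c + suc c)                    ≡⟨ cong (2 +_) (+-suc c c) ⟩
  2 + suc (c + c)                        ≤⟨ +-mono-≤ (m≤m*n 2 (2 ^ c) ⦃ m^n≢0 2 c ⦄) (1+2c≤2^1+c c) ⟩
  2 ^ suc c + 2 ^ suc c                  ≡⟨ cong (2 ^ suc c +_) (+-identityʳ _) ⟨
  2 ^ suc (suc c)                        ∎
  where open ≤-Reasoning

-- For n a power of two the logarithm is exactly `e`. The summand `c` in `e` makes n at least 2c +
-- 1, which absorbs the coefficients into one more factor n; the summand `d` makes the exponent `e`
-- exceed `d`; and 22 puts n above the threshold of `lAtLeast-n^log`.
polynomial<n^log : ∀ c d → let n = 2 ^ (c + d + 22) in suc (c * n ^ d + c) ≤ n ^ (⌊log₂ n ⌋ / 1)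
polynomial<n^log c d = begin
  suc (c * n ^ d + c)              ≤⟨ s≤s (+-monoʳ-≤ (c * n ^ d) (m≤m*n c (n ^ d))) ⟩
  suc (c * n ^ d + c * n ^ d)      ≤⟨ +-monoˡ-≤ _ (m^n>0 n d) ⟩
  n ^ d + (c * n ^ d + c * n ^ d)  ≡⟨ cong (n ^ d +_) (*-distribʳ-+ (n ^ d) c c) ⟨
  suc (c + c) * n ^ d              ≤⟨ *-monoˡ-≤ (n ^ d) (≤-trans (1+2c≤2^1+c c) (^-monoʳ-≤ 2 (suc≤e (m≤m+n c d)))) ⟩
  n ^ suc d                        ≤⟨ ^-monoʳ-≤ n (suc≤e (m≤n+m d c)) ⟩
  n ^ e                            ≡⟨ cong (n ^_) (trans (n/1≡n ⌊log₂ n ⌋) (⌊log₂[2^n]⌋≡n e)) ⟨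
  n ^ (⌊log₂ n ⌋ / 1)              ∎
  where
  open ≤-Reasoning
  e = c + d + 22
  n = 2 ^ e
  suc≤e : ∀ {k} → k ≤ c + d → suc k ≤ e
  suc≤e {k} k≤ = subst (_≤ e) (+-comm k 1) (+-mono-≤ k≤ (s≤s z≤n))
  instance
    n≢0 : NonZero n
    n≢0 = m^n≢0 2 e
    n^d≢0 : NonZero (n ^ d)
    n^d≢0 = m^n≢0 n d

theorem4 : (Σ ℕ λ k → Σ ℕ λ N → (n : ℕ) → N ≤ n → LAtLeast 4 n (n ^ (⌊log₂ n ⌋ / suc k)))
    × ((c d : ℕ) → Σ ℕ λ n → LAtLeast 4 n (suc (c * n ^ d + c)))
theorem4 = (0 , 2 ^ 22 , lAtLeast-n^log) ,
  λ c d → 2 ^ (c + d + 22) , lAtLeast-≤ (polynomial<n^log c d)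
    (lAtLeast-n^log _ (^-monoʳ-≤ 2 (m≤n+m 22 (c + d))))
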